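{- Let $(S,K,I)$ be a split graph with $|I|\ge2$ and $K=\bigcup_{v\in I}N_S(v)$. If $\Phi(S)$ is simple and connected, then $S$ is homogeneous.
   Context: All graphs are finite and simple. A split graph is a graph $S$ whose vertex set is a disjoint union $V(S)=K\,\dot\cup\,I$ with $K$ a clique and $I$ an independent set; $(K,I)$ is called a bipartition of $S$, and $(S,K,I)$ denotes $S$ together with this fixed bipartition. For a split graph $(S,K,I)$ and distinct $u,v\in I$, $\sigma_{uv}(S)$ is the number of induced subgraphs of $S$ isomorphic to $P_4$ containing both $u$ and $v$. The factor graph $\Phi(S)$ is the loopless multigraph with vertex set $I$ having exactly $\sigma_{uv}(S)$ parallel edges between $u$ and $v$; it is simple if $\sigma_{uv}(S)\in\{0,1\}$ for all $u,v$. Graph notions (connected, complete, clique, etc.) applied to $\Phi(S)$ refer to its underlying simple graph, in which $u\sim v$ iff $\sigma_{uv}(S)\ge1$. A vertex $w$ of $(S,K,I)$ is swing if $N_S(w)=K\setminus\{w\}$. $(S,K,I)$ is balanced if $|K|=\omega(S)$ and $|I|=\alpha(S)$; it is known that $S$ is balanced iff it has no swing vertex. $(S,K,I)$ is homogeneous if it is balanced and all vertices of $I$ have the same degree in $S$. -}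

module Defs where

open import Data.Bool.Base using (if_then_else_)
open import Data.Empty using (⊥-elim)
open import Data.Fin.Base using (Fin; zero; suc; toℕ)
open import Data.Fin.Properties using (_≟_; any?; all?)
open import Data.Fin.Subset using (Subset; inside; outside; _∈_; _∉_; ∣_∣)
open import Data.Fin.Subset.Properties using (_∈?_)
open import Data.List.Base using (List; []; _∷_; _++_; map; filter; length)
open import Data.List.Extrema.Nat using (max)
open import Data.List.Properties using (filter-≐)
open import Data.Nat.Base using (ℕ; zero; suc; _≤_)
open import Data.Nat.Properties using (1+n≢n)
  renaming (_≟_ to _≟ℕ_; _≤?_ to _≤?ℕ_)
open import Data.Product.Base using (Σ; ∃-syntax; _×_; _,_; proj₁; proj₂)
open import Data.Sum.Base using (_⊎_; inj₁; inj₂; swap; [_,_]′)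
open import Data.Vec.Base using (Vec; []; _∷_; tabulate; lookup)
open import Data.Vec.Properties using (lookup∘tabulate)
open import Data.Vec.Properties.WithK using ([]=-irrelevant)
open import Function.Base using (_∘_)
open import Function.Bundles using (_⇔_; _↔_; mk⇔; mk↔ₛ′; module Equivalence; module Inverse)
open import Relation.Binary.Construct.Closure.ReflexiveTransitive using (Star)
open import Relation.Binary.PropositionalEquality
  using (_≡_; _≢_; refl; sym; trans; cong; subst; subst₂)
open import Relation.Nullary using (¬_; Dec; does; yes; no)
open import Relation.Nullary.Decidable using (map′; ¬?; _×-dec_; _⊎-dec_; _→-dec_)

-- Finiteness is imposed through the vertex type, which is Fin n or a
-- subset of Fin n wherever a graph is used below.
record Graph (V : Set) : Set₁ where
  infix 4 _~_ _~?_
  field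
    _~_    : V → V → Set
    _~?_   : ∀ u v → Dec (u ~ v)
    ~-sym  : ∀ {u v} → u ~ v → v ~ u
    ~-irrefl : ∀ {v} → ¬ (v ~ v)

open Graph using (_~?_)

infix 4 _≅_
record _≅_ {V W : Set} (G : Graph V) (H : Graph W) : Set where
  private
    module G = Graph G
    module H = Graph H
  field
    bijection : V ↔ W
  open Inverse bijection public using (to; from; strictlyInverseˡ; strictlyInverseʳ)
  field
    preserves-~ : ∀ u v → (u G.~ v) ⇔ (to u H.~ to v)

⟪_⟫ : ∀ {n} → Subset n → Set
⟪_⟫ {n} W = Σ (Fin n) (_∈ W)

_[_] : ∀ {n} → Graph (Fin n) → (W : Subset n) → Graph ⟪ W ⟫
G [ W ] = record
  { _~_      = λ u v → proj₁ u G.~ proj₁ v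
  ; _~?_     = λ u v → proj₁ u G.~? proj₁ v
  ; ~-sym    = G.~-sym
  ; ~-irrefl = G.~-irrefl
  } where module G = Graph G

P : (k : ℕ) → Graph (Fin k)
P k = record
  { _~_      = λ i j → suc (toℕ i) ≡ toℕ j ⊎ suc (toℕ j) ≡ toℕ i
  ; _~?_     = λ i j → (suc (toℕ i) ≟ℕ toℕ j) ⊎-dec (suc (toℕ j) ≟ℕ toℕ i)
  ; ~-sym    = swap
  ; ~-irrefl = [ 1+n≢n , 1+n≢n ]′
  }

Connected : ∀ {V} → Graph V → Set
Connected G = ∀ u v → Star (Graph._~_ G) u v

subsets : ∀ n → List (Subset n)
subsets zero    = [] ∷ []
subsets (suc n) = map (outside ∷_) (subsets n) ++ map (inside ∷_) (subsets n)

module _ {n} (G : Graph (Fin n)) where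
  private module G = Graph G

  N : Fin n → Subset n
  N v = tabulate (λ w → does (v G.~? w))

  degree : Fin n → ℕ
  degree v = ∣ N v ∣

  IsClique : Subset n → Set
  IsClique C = ∀ u v → u ∈ C → v ∈ C → u ≢ v → u G.~ v

  IsIndependent : Subset n → Set
  IsIndependent A = ∀ u v → u ∈ A → v ∈ A → ¬ (u G.~ v)

  isClique? : ∀ C → Dec (IsClique C)
  isClique? C = all? λ u → all? λ v →
    (u ∈? C) →-dec ((v ∈? C) →-dec (¬? (u ≟ v) →-dec (u G.~? v)))

  isIndependent? : ∀ A → Dec (IsIndependent A)
  isIndependent? A = all? λ u → all? λ v →
    (u ∈? A) →-dec ((v ∈? A) →-dec ¬? (u G.~? v))

  -- The default value 0 is the size of the empty set, which is both a
  -- clique and an independent set.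
  ω : ℕ
  ω = max 0 (map ∣_∣ (filter isClique? (subsets n)))

  α : ℕ
  α = max 0 (map ∣_∣ (filter isIndependent? (subsets n)))

  -- Induced copies of P₄ are counted as vertex sets, so their isomorphism
  -- with P₄ must be decided: search for an injective adjacency-preserving
  -- and -reflecting map Fin 4 → Fin n with image W.
  private
    Traces : Subset n → Vec (Fin n) 4 → Set
    Traces W f =
      (∀ i → lookup f i ∈ W) ×
      (∀ x → x ∈ W → ∃[ i ] lookup f i ≡ x) ×
      (∀ i j → lookup f i ≡ lookup f j → i ≡ j) ×
      (∀ i j → ((lookup f i G.~ lookup f j) → P4._~_ i j) ×
               (P4._~_ i j → lookup f i G.~ lookup f j))
      where module P4 = Graph (P 4)

    traces? : ∀ W f → Dec (Traces W f)
    traces? W f =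
      (all? λ i → lookup f i ∈? W) ×-dec
      ((all? λ x → (x ∈? W) →-dec (any? λ i → lookup f i ≟ x)) ×-dec
      ((all? λ i → all? λ j → (lookup f i ≟ lookup f j) →-dec (i ≟ j)) ×-dec
      (all? λ i → all? λ j →
        ((lookup f i G.~? lookup f j) →-dec (P 4 ._~?_ i j)) ×-dec
        ((P 4 ._~?_ i j) →-dec (lookup f i G.~? lookup f j)))))

    ⟪⟫-≡ : ∀ {W : Subset n} {x y : ⟪ W ⟫} → proj₁ x ≡ proj₁ y → x ≡ y
    ⟪⟫-≡ {x = x , p} {.x , q} refl = cong (x ,_) ([]=-irrelevant p q)

    traces⇒≅ : ∀ {W} f → Traces W f → G [ W ] ≅ P 4
    traces⇒≅ {W} f (f∈ , onto , inj , adj) = record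
      { bijection   = mk↔ₛ′ to (λ i → lookup f i , f∈ i)
          (λ i → inj _ _ (f∘to (lookup f i , f∈ i)))
          (λ x → ⟪⟫-≡ (f∘to x))
      ; preserves-~ = λ u v → mk⇔
          (λ u~v → proj₁ (adj (to u) (to v))
            (subst₂ G._~_ (sym (f∘to u)) (sym (f∘to v)) u~v))
          (λ p → subst₂ G._~_ (f∘to u) (f∘to v) (proj₂ (adj (to u) (to v)) p))
      }
      where
      to : ⟪ W ⟫ → Fin 4
      to (x , x∈W) = proj₁ (onto x x∈W)
      f∘to : ∀ x → lookup f (to x) ≡ proj₁ x
      f∘to (x , x∈W) = proj₂ (onto x x∈W)

    ≅⇒traces : ∀ {W} (iso : G [ W ] ≅ P 4) →
               Traces W (tabulate (proj₁ ∘ _≅_.from iso))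
    ≅⇒traces {W} iso =
      (λ i → subst (_∈ W) (sym (l∘t i)) (proj₂ (from i))) ,
      (λ x x∈W → to (x , x∈W) ,
        trans (l∘t _) (cong proj₁ (strictlyInverseʳ (x , x∈W)))) ,
      (λ i j eq → trans (sym (strictlyInverseˡ i))
        (trans (cong to (⟪⟫-≡ (trans (sym (l∘t i)) (trans eq (l∘t j)))))
               (strictlyInverseˡ j))) ,
      (λ i j →
        (λ a → subst₂ P4._~_ (strictlyInverseˡ i) (strictlyInverseˡ j)
          (Equivalence.to (preserves-~ (from i) (from j))
            (subst₂ G._~_ (l∘t i) (l∘t j) a))) ,
        (λ p → subst₂ G._~_ (sym (l∘t i)) (sym (l∘t j))
          (Equivalence.from (preserves-~ (from i) (from j))
            (subst₂ P4._~_ (sym (strictlyInverseˡ i)) (sym (strictlyInverseˡ j)) p))))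
      where
      open _≅_ iso
      module P4 = Graph (P 4)
      l∘t = lookup∘tabulate (proj₁ ∘ from)

  inducesP₄? : ∀ W → Dec (G [ W ] ≅ P 4)
  inducesP₄? W = map′
    (λ (a , b , c , d , t) → traces⇒≅ (a ∷ b ∷ c ∷ d ∷ []) t)
    (λ iso → _ , _ , _ , _ , ≅⇒traces iso)
    (any? λ a → any? λ b → any? λ c → any? λ d →
      traces? W (a ∷ b ∷ c ∷ d ∷ []))

  IsP₄Through : Fin n → Fin n → Subset n → Set
  IsP₄Through u v W = u ∈ W × v ∈ W × G [ W ] ≅ P 4

  isP₄Through? : ∀ u v W → Dec (IsP₄Through u v W)
  isP₄Through? u v W = (u ∈? W) ×-dec ((v ∈? W) ×-dec inducesP₄? W)

  σ : Fin n → Fin n → ℕ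
  σ u v = length (filter (isP₄Through? u v) (subsets n))

  σ-sym : ∀ u v → σ u v ≡ σ v u
  σ-sym u v = cong length (filter-≐ (isP₄Through? u v) (isP₄Through? v u)
    ((λ (p , q , r) → q , p , r) , (λ (p , q , r) → q , p , r)) (subsets n))

record Multigraph (V : Set) : Set where
  field
    mult          : V → V → ℕ
    mult-sym      : ∀ u v → mult u v ≡ mult v u
    mult-loopless : ∀ v → mult v v ≡ 0

Simple : ∀ {V} → Multigraph V → Set
Simple M = ∀ u v → mult u v ≤ 1
  where open Multigraph M

underlying : ∀ {V} → Multigraph V → Graph V
underlying M = record
  { _~_      = λ u v → 1 ≤ mult u v
  ; _~?_     = λ u v → 1 ≤?ℕ mult u v
  ; ~-sym    = λ {u} {v} → subst (1 ≤_) (mult-sym u v)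
  ; ~-irrefl = λ {v} 1≤m → 1≰0 (subst (1 ≤_) (mult-loopless v) 1≤m)
  }
  where
  open Multigraph M
  1≰0 : ¬ (1 ≤ 0)
  1≰0 ()

record SplitGraph (n : ℕ) : Set₁ where
  field
    graph         : Graph (Fin n)
    K I           : Subset n
    cover         : ∀ v → v ∈ K ⊎ v ∈ I
    disjoint      : ∀ v → v ∈ K → v ∉ I
    K-clique      : IsClique graph K
    I-independent : IsIndependent graph I

module _ {n} (S : SplitGraph n) where
  open SplitGraph S

  Φ : Multigraph ⟪ I ⟫
  Φ = record
    { mult          = λ (u , _) (v , _) → edges u v
    ; mult-sym      = λ (u , _) (v , _) → edges-sym u v
    ; mult-loopless = λ (v , _) → edges-loopless v
    }
    where
    edges : Fin n → Fin n → ℕ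
    edges u v = if does (u ≟ v) then 0 else σ graph u v

    edges-sym : ∀ u v → edges u v ≡ edges v u
    edges-sym u v with u ≟ v | v ≟ u
    ... | yes _   | yes _   = refl
    ... | yes u≡v | no v≢u  = ⊥-elim (v≢u (sym u≡v))
    ... | no u≢v  | yes v≡u = ⊥-elim (u≢v (sym v≡u))
    ... | no _    | no _    = σ-sym graph u v

    edges-loopless : ∀ v → edges v v ≡ 0
    edges-loopless v with v ≟ v
    ... | yes _  = refl
    ... | no v≢v = ⊥-elim (v≢v refl)

  Balanced : Set
  Balanced = ∣ K ∣ ≡ ω graph × ∣ I ∣ ≡ α graph

  Homogeneous : Set
  Homogeneous = Balanced ×
    (∀ u v → u ∈ I → v ∈ I → degree graph u ≡ degree graph v)

{-# OPTIONS --safe #-}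
-- In a split graph an induced P₄ has its ends in I and its middle in K, so
-- those through u, v ∈ I are the u − a − b − v with a ∈ N(u) ∖ N(v) and
-- b ∈ N(v) ∖ N(u).  If there is exactly one, both differences are singletons
-- and u and v have equal degree; connectedness of Φ(S) spreads this over I.
-- For balance, exchange: a clique meeting I in w may lose w and gain an element
-- of K ∖ N(w), which exists since w is not isolated in Φ(S); an independent set
-- meeting K in x may lose x and gain a neighbour of x in I.
module Submission where

open import Data.Bool.Base using (true)
open import Data.Fin.Base using (Fin; zero; suc)
open import Data.Fin.Patterns using (0F; 1F; 2F; 3F)
open import Data.Fin.Properties using (_≟_; any?; all?)
open import Data.Fin.Subset using (Subset; inside; outside; _∈_; _∉_; _⊆_; _-_; ∣_∣; ⁅_⁆)
open import Data.Fin.Subset.Properties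
  using (_∈?_; p─⊥≡p; p─q⊆p; p⊆q⇒∣p∣≤∣q∣; p⊂q⇒∣p∣<∣q∣; ∣⁅x⁆∣≡1; x∈⁅x⁆)
open import Data.List.Base using (List; []; _∷_; map; filter; length)
open import Data.List.Extrema.Nat using (max; max≈v⁺)
import Data.List.Membership.Propositional as List
open import Data.List.Membership.Propositional.Properties
  using (∈-filter⁺; ∈-filter⁻; ∈-map⁺; ∈-++⁺ˡ; ∈-++⁺ʳ)
open import Data.List.Relation.Unary.All.Properties using (map⁺; all-filter)
import Data.List.Relation.Unary.Any as Any
import Data.List.Relation.Unary.All as All
open import Data.Nat.Base using (suc; _≤_; s≤s; z≤n)
open import Data.Nat.Properties using (≤-antisym; ≤-trans; ≤-reflexive; n≤1+n)
open import Data.Product.Base using (_×_; _,_; ∃-syntax; proj₁; proj₂)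
open import Data.Sum.Base using (inj₁; inj₂)
open import Data.Vec.Base using ([]; _∷_; tabulate; lookup; here; there)
open import Data.Vec.Properties using (lookup∘tabulate; []=⇒lookup; lookup⇒[]=)
open import Data.Vec.Properties.WithK using ([]=-irrelevant)
open import Function.Base using (_∘_)
open import Function.Bundles using (_⇔_; mk⇔; mk↔ₛ′; module Equivalence)
open import Relation.Binary.Construct.Closure.ReflexiveTransitive using (Star; ε; _◅_)
open import Relation.Binary.PropositionalEquality
  using (_≡_; _≢_; refl; sym; trans; cong; subst; subst₂)
open import Relation.Nullary using (¬_; does; yes; no; contradiction)
open import Relation.Nullary.Decidable
  using (dec-true; decidable-stable; from-yes; True; False; toWitness; toWitnessFalse; _×-dec_; _→-dec_; ¬?)
open import Relation.Unary using (Decidable)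
open import Defs

open Equivalence using (to; from)

-- Cardinalities of finite subsets.

∈-tabulate : ∀ {n} {P : Fin n → Set} (P? : Decidable P) {x} →
             x ∈ tabulate (does ∘ P?) ⇔ P x
∈-tabulate {P = P} P? {x} = mk⇔
  (λ x∈ → witness (trans (sym (lookup∘tabulate (does ∘ P?) x)) ([]=⇒lookup x∈)))
  (λ p → lookup⇒[]= x _ (trans (lookup∘tabulate (does ∘ P?) x) (dec-true (P? x) p)))
  where
  witness : does (P? x) ≡ true → P x
  witness eq with P? x
  ... | yes p = p
  witness () | no _

∣p∣≤1+∣p-x∣ : ∀ {n} (p : Subset n) x → ∣ p ∣ ≤ suc ∣ p - x ∣
∣p∣≤1+∣p-x∣ (inside  ∷ p) zero    = s≤s (≤-reflexive (cong ∣_∣ (sym (p─⊥≡p p))))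
∣p∣≤1+∣p-x∣ (outside ∷ p) zero    = ≤-trans (≤-reflexive (cong ∣_∣ (sym (p─⊥≡p p)))) (n≤1+n _)
∣p∣≤1+∣p-x∣ (inside  ∷ p) (suc x) = s≤s (∣p∣≤1+∣p-x∣ p x)
∣p∣≤1+∣p-x∣ (outside ∷ p) (suc x) = ∣p∣≤1+∣p-x∣ p x

x∉p-x : ∀ {n} (p : Subset n) x → x ∉ p - x
x∉p-x (s ∷ p) (suc x) (there x∈) = x∉p-x p x x∈

-- Removing `x` costs `p` at most one element, and `p - x` is a proper subset of `q` because it
-- misses `y`.
exchange : ∀ {n} {p q : Subset n} {x y} → (∀ {z} → z ∈ p → z ≢ x → z ∈ q) →
           y ∈ q → (y ∈ p → y ≡ x) → ∣ p ∣ ≤ ∣ q ∣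
exchange {p = p} {q} {x} {y} p-x⊆q y∈q y∈p⇒y≡x =
  ≤-trans (∣p∣≤1+∣p-x∣ p x) (p⊂q⇒∣p∣<∣q∣
    ( (λ z∈ → p-x⊆q (p─q⊆p p ⁅ x ⁆ z∈) λ { refl → x∉p-x p x z∈ })
    , y , y∈q
    , λ y∈ → x∉p-x p x (subst (_∈ p - x) (y∈p⇒y≡x (p─q⊆p p ⁅ x ⁆ y∈)) y∈)))

another : ∀ {n} {p : Subset n} → 2 ≤ ∣ p ∣ → ∀ x → ∃[ y ] (y ∈ p × y ≢ x)
another {p = p} 2≤∣p∣ x with any? (λ y → (y ∈? p) ×-dec ¬? (y ≟ x))
... | yes found = found
... | no  none  = contradiction 2≤1 λ { (s≤s ()) }
  where
  p⊆⁅x⁆ : p ⊆ ⁅ x ⁆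
  p⊆⁅x⁆ {y} y∈p with y ≟ x
  ... | yes refl = x∈⁅x⁆ x
  ... | no  y≢x  = contradiction (y , y∈p , y≢x) none
  2≤1 : 2 ≤ 1
  2≤1 = ≤-trans 2≤∣p∣ (≤-trans (p⊆q⇒∣p∣≤∣q∣ p⊆⁅x⁆) (≤-reflexive (∣⁅x⁆∣≡1 x)))

-- Maxima and counts over the list of all subsets.

⟪⟫-≡ : ∀ {n} {W : Subset n} {x y : ⟪ W ⟫} → proj₁ x ≡ proj₁ y → x ≡ y
⟪⟫-≡ {x = x , p} {.x , q} refl = cong (x ,_) ([]=-irrelevant p q)

∈-subsets : ∀ {n} (p : Subset n) → p List.∈ subsets n
∈-subsets []            = Any.here refl
∈-subsets (outside ∷ p) = ∈-++⁺ˡ (∈-map⁺ (outside ∷_) (∈-subsets p))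
∈-subsets (inside  ∷ p) = ∈-++⁺ʳ (map (outside ∷_) (subsets _)) (∈-map⁺ (inside ∷_) (∈-subsets p))

-- Serves for both `ω` and `α`: the maximum is bounded by `∣ A ∣` and attained at `A`.
max-∣∣ : ∀ {n} {P : Subset n → Set} (P? : Decidable P) {A} → P A →
         (∀ B → P B → ∣ B ∣ ≤ ∣ A ∣) → ∣ A ∣ ≡ max 0 (map ∣_∣ (filter P? (subsets n)))
max-∣∣ {n} P? {A} pA bound = sym (max≈v⁺
  (∈-map⁺ ∣_∣ (∈-filter⁺ P? (∈-subsets A) pA))
  (map⁺ (All.map (bound _) (all-filter P? (subsets n))))
  -- The default 0 of `max` must not exceed `∣ A ∣` either.
  z≤n)

length≤1⇒≡ : ∀ {A : Set} {x y : A} {xs} → length xs ≤ 1 → x List.∈ xs → y List.∈ xs → x ≡ y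
length≤1⇒≡ {xs = _ ∷ []}    _        (Any.here refl) (Any.here refl) = refl
length≤1⇒≡ {xs = _ ∷ _ ∷ _} (s≤s ()) _               _

1≤length⇒∈ : ∀ {A : Set} {xs : List A} → 1 ≤ length xs → ∃[ x ] x List.∈ xs
1≤length⇒∈ {xs = x ∷ _} _ = x , Any.here refl

-- Induced copies of P₄ from maps on four points.

image : ∀ {k n} → (Fin k → Fin n) → Subset n
image f = tabulate λ x → does (any? λ i → f i ≟ x)

∈-image : ∀ {k n} (f : Fin k → Fin n) {x} → x ∈ image f ⇔ (∃[ i ] f i ≡ x)
∈-image f = ∈-tabulate λ x → any? λ i → f i ≟ x

module P₄ = Graph (P 4)

-- The four neighbourhoods {1}, {0,2}, {1,3}, {2} are distinct; a finite check decides it.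
P₄-twin-free : ∀ i j → (∀ k → i P₄.~ k → j P₄.~ k) → (∀ k → j P₄.~ k → i P₄.~ k) → i ≡ j
P₄-twin-free = from-yes (all? λ i → all? λ j →
  (all? λ k → (i P₄.~? k) →-dec (j P₄.~? k)) →-dec
  ((all? λ k → (j P₄.~? k) →-dec (i P₄.~? k)) →-dec (i ≟ j)))

-- Injectivity of `f` follows from the adjacency condition: indices with equal images have the same
-- neighbours in P₄, hence coincide.
image≅P₄ : ∀ {n} (G : Graph (Fin n)) (f : Fin 4 → Fin n) →
           (∀ i j → Graph._~_ G (f i) (f j) ⇔ i P₄.~ j) → G [ image f ] ≅ P 4
image≅P₄ G f adj = record
  { bijection   = mk↔ₛ′ index (λ i → f i , from (∈-image f) (i , refl))
      (λ i → injective (f∘index (f i , from (∈-image f) (i , refl))))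
      (λ x → ⟪⟫-≡ (f∘index x))
  ; preserves-~ = λ x y → mk⇔
      (λ x~y → to (adj _ _) (subst₂ G._~_ (sym (f∘index x)) (sym (f∘index y)) x~y))
      (λ i~j → subst₂ G._~_ (f∘index x) (f∘index y) (from (adj _ _) i~j))
  }
  where
  module G = Graph G
  index : ⟪ image f ⟫ → Fin 4
  index (_ , x∈) = proj₁ (to (∈-image f) x∈)
  f∘index : ∀ x → f (index x) ≡ proj₁ x
  f∘index (_ , x∈) = proj₂ (to (∈-image f) x∈)
  same-neighbours : ∀ {i j} → f i ≡ f j → ∀ k → i P₄.~ k → j P₄.~ k
  same-neighbours fi≡fj k i~k = to (adj _ k) (subst (G._~ f k) fi≡fj (from (adj _ k) i~k))
  injective : ∀ {i j} → f i ≡ f j → i ≡ j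
  injective eq = P₄-twin-free _ _ (same-neighbours eq) (same-neighbours (sym eq))

module _ {n} (G : Graph (Fin n)) where
  open Graph G

  ∈-N : ∀ {v w} → w ∈ N G v ⇔ v ~ w
  ∈-N {v} = ∈-tabulate (v ~?_)

  σ≤1⇒≡ : ∀ {u v W W′} → σ G u v ≤ 1 → IsP₄Through G u v W → IsP₄Through G u v W′ → W ≡ W′
  σ≤1⇒≡ {u} {v} σ≤1 p q = length≤1⇒≡ σ≤1
    (∈-filter⁺ (isP₄Through? G u v) (∈-subsets _) p)
    (∈-filter⁺ (isP₄Through? G u v) (∈-subsets _) q)

  1≤σ⇒P₄ : ∀ {u v} → 1 ≤ σ G u v → ∃[ W ] IsP₄Through G u v W
  1≤σ⇒P₄ {u} {v} 1≤σ =
    let W , W∈ = 1≤length⇒∈ 1≤σ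
    in  W , proj₂ (∈-filter⁻ (isP₄Through? G u v) {xs = subsets n} W∈)

  Private : Fin n → Fin n → Fin n → Set
  Private u v a = u ~ a × ¬ (v ~ a)

-- Induced copies of P₄ in a split graph.

module _ {n} (S : SplitGraph n) where
  open SplitGraph S
  open Graph graph

  ∉I⇒∈K : ∀ {x} → x ∉ I → x ∈ K
  ∉I⇒∈K {x} x∉I with cover x
  ... | inj₁ x∈K = x∈K
  ... | inj₂ x∈I = contradiction x∈I x∉I

  ∉K⇒∈I : ∀ {x} → x ∉ K → x ∈ I
  ∉K⇒∈I {x} x∉K with cover x
  ... | inj₁ x∈K = contradiction x∈K x∉K
  ... | inj₂ x∈I = x∈I

  ~I⇒∈K : ∀ {v x} → v ∈ I → v ~ x → x ∈ K
  ~I⇒∈K v∈I v~x = ∉I⇒∈K λ x∈I → I-independent _ _ v∈I x∈I v~x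

  -- If `m` were in `I`, its neighbours `x` and `y` would lie in the clique `K` and be adjacent.
  centre∈K : ∀ {x m y} → m ~ x → m ~ y → x ≢ y → ¬ (x ~ y) → m ∈ K
  centre∈K m~x m~y x≢y x≁y = ∉I⇒∈K λ m∈I →
    x≁y (K-clique _ _ (~I⇒∈K m∈I m~x) (~I⇒∈K m∈I m~y) x≢y)

  -- Each inner vertex of the path is the centre of an induced P₃, hence in `K`. So `u` and `v` are
  -- the two ends, in some order, and the inner neighbour of each is private to it.
  P₄⇒Private : ∀ {u v W} → u ∈ I → v ∈ I → u ≢ v → IsP₄Through graph u v W →
               (∃[ a ] Private graph u v a) × (∃[ b ] Private graph v u b)
  P₄⇒Private {u} {v} {W} u∈I v∈I u≢v (u∈W , v∈W , iso) =
    ends _ _ (cong proj₁ (iso.strictlyInverseʳ (u , u∈W)))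
             (cong proj₁ (iso.strictlyInverseʳ (v , v∈W))) u∈I v∈I u≢v
    where
    module iso = _≅_ iso
    pt : Fin 4 → Fin n
    pt i = proj₁ (iso.from i)
    adj : ∀ i j → pt i ~ pt j ⇔ i P₄.~ j
    adj i j = mk⇔
      (λ p → subst₂ P₄._~_ (iso.strictlyInverseˡ i) (iso.strictlyInverseˡ j)
               (to (iso.preserves-~ _ _) p))
      (λ q → from (iso.preserves-~ _ _)
               (subst₂ P₄._~_ (sym (iso.strictlyInverseˡ i)) (sym (iso.strictlyInverseˡ j)) q))
    edge : ∀ i j {_ : True (i P₄.~? j)} → pt i ~ pt j
    edge i j {t} = from (adj i j) (toWitness t)
    nonedge : ∀ i j {_ : False (i P₄.~? j)} → ¬ (pt i ~ pt j)
    nonedge i j {f} = toWitnessFalse f ∘ to (adj i j)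
    1∉I : pt 1F ∉ I
    1∉I = disjoint _ (centre∈K (edge 1F 0F) (edge 1F 2F)
      -- Points 0 and 2 differ because point 3 is adjacent to 2 but not to 0.
      (λ eq → nonedge 3F 0F (subst (pt 3F ~_) (sym eq) (edge 3F 2F))) (nonedge 0F 2F))
    2∉I : pt 2F ∉ I
    2∉I = disjoint _ (centre∈K (edge 2F 1F) (edge 2F 3F)
      (λ eq → nonedge 0F 3F (subst (pt 0F ~_) eq (edge 0F 1F))) (nonedge 1F 3F))
    -- `u` and `v` become variables here, so that their equations with `pt i` and `pt j` can be
    -- matched by `refl`.
    ends : ∀ i j {x y} → pt i ≡ x → pt j ≡ y → x ∈ I → y ∈ I → x ≢ y →
           (∃[ a ] Private graph x y a) × (∃[ b ] Private graph y x b)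
    ends 1F _  refl _    x∈ _  _ = contradiction x∈ 1∉I
    ends 2F _  refl _    x∈ _  _ = contradiction x∈ 2∉I
    ends 0F 1F _    refl _  y∈ _ = contradiction y∈ 1∉I
    ends 3F 1F _    refl _  y∈ _ = contradiction y∈ 1∉I
    ends 0F 2F _    refl _  y∈ _ = contradiction y∈ 2∉I
    ends 3F 2F _    refl _  y∈ _ = contradiction y∈ 2∉I
    ends 0F 0F refl refl _  _  ≢ = contradiction refl ≢
    ends 3F 3F refl refl _  _  ≢ = contradiction refl ≢
    ends 0F 3F refl refl _  _  _ =
      (pt 1F , edge 0F 1F , nonedge 3F 1F) , (pt 2F , edge 3F 2F , nonedge 0F 2F)
    ends 3F 0F refl refl _  _  _ =
      (pt 2F , edge 3F 2F , nonedge 0F 2F) , (pt 1F , edge 0F 1F , nonedge 3F 1F)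

  path : (u a b v : Fin n) → Fin 4 → Fin n
  path u a b v = lookup (u ∷ a ∷ b ∷ v ∷ [])

  -- `a` and `b` lie in `K` and differ, since `u` sees only `a`; so they are adjacent and u - a - b
  -- - v is an induced path.
  Private⇒P₄ : ∀ {u v a b} → u ∈ I → v ∈ I → Private graph u v a → Private graph v u b →
               IsP₄Through graph u v (image (path u a b v))
  Private⇒P₄ {u} {v} {a} {b} u∈I v∈I (u~a , v≁a) (v~b , u≁b) =
    from (∈-image f) (0F , refl) , from (∈-image f) (3F , refl) , image≅P₄ graph f adj
    where
    f : Fin 4 → Fin n
    f = path u a b v
    a~b : a ~ b
    a~b = K-clique _ _ (~I⇒∈K u∈I u~a) (~I⇒∈K v∈I v~b) λ { refl → u≁b u~a }
    u≁v : ¬ (u ~ v)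
    u≁v = I-independent _ _ u∈I v∈I
    both : ∀ {i j} {_ : True (i P₄.~? j)} → f i ~ f j → f i ~ f j ⇔ i P₄.~ j
    both {i} {j} {t} p = mk⇔ (λ _ → toWitness t) (λ _ → p)
    neither : ∀ {i j} {_ : False (i P₄.~? j)} → ¬ (f i ~ f j) → f i ~ f j ⇔ i P₄.~ j
    neither {i} {j} {t} ¬p = mk⇔ (λ p → contradiction p ¬p) (λ q → contradiction q (toWitnessFalse t))
    adj : ∀ i j → f i ~ f j ⇔ i P₄.~ j
    adj 0F 0F = neither ~-irrefl
    adj 0F 1F = both u~a
    adj 0F 2F = neither u≁b
    adj 0F 3F = neither u≁v
    adj 1F 0F = both (~-sym u~a)
    adj 1F 1F = neither ~-irrefl
    adj 1F 2F = both a~b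
    adj 1F 3F = neither (v≁a ∘ ~-sym)
    adj 2F 0F = neither (u≁b ∘ ~-sym)
    adj 2F 1F = both (~-sym a~b)
    adj 2F 2F = neither ~-irrefl
    adj 2F 3F = both (~-sym v~b)
    adj 3F 0F = neither (u≁v ∘ ~-sym)
    adj 3F 1F = neither v≁a
    adj 3F 2F = both v~b
    adj 3F 3F = neither ~-irrefl

  -- The paths through `a` and `a′`, completed by the same `b`, have the same vertex set, so `a′` is
  -- one of `u`, `a`, `b`, `v`. Adjacency rules out all but `a`.
  Private-unique : ∀ {u v a a′ b} → σ graph u v ≤ 1 → u ∈ I → v ∈ I →
                   Private graph u v a → Private graph v u b → Private graph u v a′ → a′ ≡ a
  Private-unique {u} {v} {a} {a′} {b} σ≤1 u∈I v∈I pa pb@(v~b , _) pa′@(u~a′ , v≁a′) =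
    locate (to (∈-image (path u a b v)) a′∈)
    where
    a′∈ : a′ ∈ image (path u a b v)
    a′∈ = subst (a′ ∈_)
      (σ≤1⇒≡ graph σ≤1 (Private⇒P₄ u∈I v∈I pa′ pb) (Private⇒P₄ u∈I v∈I pa pb))
      (from (∈-image (path u a′ b v)) (1F , refl))
    locate : ∃[ i ] path u a b v i ≡ a′ → a′ ≡ a
    locate (0F , refl) = contradiction u~a′ ~-irrefl
    locate (1F , refl) = refl
    locate (2F , refl) = contradiction v~b v≁a′
    locate (3F , refl) = contradiction u~a′ (I-independent _ _ u∈I v∈I)

  -- Edges of the factor graph and degrees.

  module Φ = Graph (underlying (Φ S))

  -- Multiplicity at least 1 excludes the diagonal branch, whose value is 0, so the conditional
  -- defining `Φ` reduces to `σ`.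
  Φ-edge⇒σ : ∀ {u v : ⟪ I ⟫} → u Φ.~ v →
             proj₁ u ≢ proj₁ v × Multigraph.mult (Φ S) u v ≡ σ graph (proj₁ u) (proj₁ v)
  Φ-edge⇒σ {u , _} {v , _} u~v with u ≟ v
  Φ-edge⇒σ () | yes _
  ... | no u≢v = u≢v , refl

  Φ-edge⇒Private : ∀ {u v : ⟪ I ⟫} → u Φ.~ v →
    (∃[ a ] Private graph (proj₁ u) (proj₁ v) a) × (∃[ b ] Private graph (proj₁ v) (proj₁ u) b)
  Φ-edge⇒Private {u , u∈I} {v , v∈I} u~v =
    let u≢v , mult≡σ = Φ-edge⇒σ {u , u∈I} {v , v∈I} u~v
    in  P₄⇒Private u∈I v∈I u≢v (proj₂ (1≤σ⇒P₄ graph (subst (1 ≤_) mult≡σ u~v)))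

  module _ (simple : Simple (Φ S)) where

    -- Trade `a` for `b`: every neighbour of `u` other than `a` is a neighbour of `v`, while `b` is
    -- a neighbour of `v` only. Symmetry of edges later gives the reverse inequality.
    degree-mono : ∀ {u v : ⟪ I ⟫} → u Φ.~ v → degree graph (proj₁ u) ≤ degree graph (proj₁ v)
    degree-mono {u , u∈I} {v , v∈I} u~v =
      let (a , pa) , (b , pb@(v~b , u≁b)) = Φ-edge⇒Private {u , u∈I} {v , v∈I} u~v
          _ , mult≡σ = Φ-edge⇒σ {u , u∈I} {v , v∈I} u~v
          σ≤1 = subst (_≤ 1) mult≡σ (simple (u , u∈I) (v , v∈I))
      in  exchange {x = a}
        (λ x∈Nu x≢a → from (∈-N graph) (decidable-stable (v ~? _) λ v≁x →
          x≢a (Private-unique σ≤1 u∈I v∈I pa pb (to (∈-N graph) x∈Nu , v≁x))))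
        (from (∈-N graph) v~b)
        (λ b∈Nu → contradiction (to (∈-N graph) b∈Nu) u≁b)

    degree-≡ : ∀ {u v : ⟪ I ⟫} → Star Φ._~_ u v → degree graph (proj₁ u) ≡ degree graph (proj₁ v)
    degree-≡ ε = refl
    degree-≡ {u} (_◅_ {j = w} u~w w⇝v) =
      trans (≤-antisym (degree-mono {u} {w} u~w) (degree-mono {w} {u} (Φ.~-sym {u} {w} u~w)))
            (degree-≡ w⇝v)

  -- Balance by exchange.

  Dominated : Set
  Dominated = ∀ {x} → x ∈ K → ∃[ v ] (v ∈ I × x ∈ N graph v)

  α≡∣I∣ : Dominated → ∣ I ∣ ≡ α graph
  α≡∣I∣ dominated = max-∣∣ (isIndependent? graph) I-independent bound
    where
    bound : ∀ A → IsIndependent graph A → ∣ A ∣ ≤ ∣ I ∣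
    bound A indep with any? (λ x → (x ∈? A) ×-dec (x ∈? K))
    ... | no  none = p⊆q⇒∣p∣≤∣q∣ λ x∈A → ∉K⇒∈I λ x∈K → none (_ , x∈A , x∈K)
    ... | yes (x , x∈A , x∈K) =
      let v , v∈I , x∈Nv = dominated x∈K in
      exchange {x = x}
        -- A second element of `K` in `A` would be adjacent to `x`, so the rest of `A` lies in `I`.
        (λ z∈A z≢x → ∉K⇒∈I λ z∈K → indep _ _ z∈A x∈A (K-clique _ _ z∈K x∈K z≢x))
        v∈I
        (λ v∈A → contradiction (to (∈-N graph) x∈Nv) (indep _ _ v∈A x∈A))

  ω≡∣K∣ : (∀ {w} → w ∈ I → ∃[ b ] (b ∈ K × ¬ (w ~ b))) → ∣ K ∣ ≡ ω graph
  ω≡∣K∣ missed = max-∣∣ (isClique? graph) K-clique bound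
    where
    bound : ∀ C → IsClique graph C → ∣ C ∣ ≤ ∣ K ∣
    bound C clique with any? (λ w → (w ∈? C) ×-dec (w ∈? I))
    ... | no  none = p⊆q⇒∣p∣≤∣q∣ λ x∈C → ∉I⇒∈K λ x∈I → none (_ , x∈C , x∈I)
    ... | yes (w , w∈C , w∈I) =
      let b , b∈K , w≁b = missed w∈I in
      exchange {x = w}
        -- The rest of `C` consists of neighbours of `w`, which lies in `I`, so it is contained in
        -- `K`.
        (λ z∈C z≢w → ~I⇒∈K w∈I (clique _ _ w∈C z∈C (z≢w ∘ sym)))
        b∈K
        (λ b∈C → decidable-stable (b ≟ w) λ b≢w → w≁b (clique _ _ w∈C b∈C (b≢w ∘ sym)))

  -- A walk in `Φ` from `w` to a second vertex of `I` starts with an edge to some `x`; a neighbour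
  -- of `x` private against `w` is the required `b`.
  Φ-connected⇒missed : 2 ≤ ∣ I ∣ → Connected (underlying (Φ S)) →
                       ∀ {w} → w ∈ I → ∃[ b ] (b ∈ K × ¬ (w ~ b))
  Φ-connected⇒missed 2≤∣I∣ connected {w} w∈I with another 2≤∣I∣ w
  ... | v , v∈I , v≢w with connected (w , w∈I) (v , v∈I)
  ... | ε = contradiction refl v≢w
  ... | _◅_ {j = x , x∈I} w~x _ =
    let _ , (b , x~b , w≁b) = Φ-edge⇒Private {w , w∈I} {x , x∈I} w~x
    in  b , ~I⇒∈K x∈I x~b , w≁b

theorem3p3 : ∀ {n} (S : SplitGraph n) → let open SplitGraph S in
    2 ≤ ∣ I ∣ →
    (∀ x → x ∈ K ⇔ (∃[ v ] (v ∈ I × x ∈ N graph v))) →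
    Simple (Φ S) →
    Connected (underlying (Φ S)) →
    Homogeneous S
theorem3p3 S 2≤∣I∣ K≡⋃N simple connected =
  (ω≡∣K∣ S (Φ-connected⇒missed S 2≤∣I∣ connected) , α≡∣I∣ S (λ {x} → to (K≡⋃N x))) ,
  λ u v u∈I v∈I → degree-≡ S simple (connected (u , u∈I) (v , v∈I))
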